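{- Let $t$ be a term such that $\Lambda\vdash t:L$ is derivable in the intersection type system, where $\Lambda$ is a ground context and $L$ is a ground type. Then $t\to^* u$ for some term $u$ which is a low-level term in normal form (i.e. there is no $u'$ with $u\to u'$).
   Context: **Terms.** Fix a countable set of variables. Terms $t,u$ and values $v,w$ are given (up to $\alpha$-equivalence) by $t,u ::= v \mid \mathsf{sample}_d \mid \mathsf{case}\ v\ \mathsf{of}\ \{v_i\Rightarrow \mathsf{sample}_{d_i}\} \mid \mathsf{obs}(x=b) \mid \mathsf{let}\ x=u\ \mathsf{in}\ t \mid \mathsf{letp}\ \langle x,y\rangle=v\ \mathsf{in}\ t \mid t\,v\mid \lambda x.t\mid \mathsf{der}\,v$; $v,w ::= x \mid \langle v,w\rangle \mid\ !t \mid b$; $b::=\mathtt t\mid\mathtt f$; here $d$ ranges over probability distributions on $\{\mathtt t,\mathtt f\}$. We write $\mathsf c\langle y_1,\dots,y_n\rangle$ for $\mathsf{case}\ \langle y_1,\dots,y_n\rangle\ \mathsf{of}\ \{\bar b\Rightarrow\mathsf{sample}_{d_{\bar b}}\}_{\bar b\in\{\mathtt t,\mathtt f\}^n}$ (tuples are nested pairs). A *low-level term* is one generated by $t,u ::= v \mid \mathsf{sample}_d \mid \mathsf{case}\ v\ \mathsf{of}\ \{\bar b\Rightarrow \mathsf{sample}_{d_{\bar b}}\} \mid \mathsf{obs}(x=b) \mid \mathsf{let}\ x=u\ \mathsf{in}\ t \mid \mathsf{letp}\ \langle x,y\rangle=v\ \mathsf{in}\ t$ with values $v,w::= x\mid\langle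 v,w\rangle\mid\mathtt t\mid\mathtt f$. **Reduction.** Substitution lists: $S::=\langle\!\langle\cdot\rangle\!\rangle\mid \mathsf{let}\ x=u\ \mathsf{in}\ S\mid\mathsf{letp}\ \langle x,y\rangle=v\ \mathsf{in}\ S$; $\langle\!\langle t\rangle\!\rangle S$ is $S$ with its hole replaced by $t$ (variables of $t$ may be captured). Root rules (by $\alpha$-equivalence, bound variables of $S$ are chosen not to capture variables of the other part of the redex): $(\langle\!\langle\lambda x.t\rangle\!\rangle S)\,v\mapsto\langle\!\langle t\{x\leftarrow v\}\rangle\!\rangle S$; $\ \mathsf{let}\ x=\langle\!\langle v\rangle\!\rangle S\ \mathsf{in}\ t\mapsto\langle\!\langle t\{x\leftarrow v\}\rangle\!\rangle S$; $\ \mathsf{der}\,!t\mapsto t$; $\ \mathsf{letp}\ \langle x,y\rangle=\langle v,w\rangle\ \mathsf{in}\ t\mapsto t\{x\leftarrow v\}\{y\leftarrow w\}$. The reduction $\to$ is the closure of $\mapsto$ under evaluation contexts $E::=(\cdot)\mid E\,v\mid\mathsf{let}\ x=E\ \mathsf{in}\ t\mid\mathsf{let}\ x=u\ \mathsf{in}\ E$; $\to^*$ is its reflexive-transitive closure. **Intersection types.** Fix a countable set of names $X,Y,Z,\dots$. Ground types $K,L::=X\mid K\otimes L$; positive types $P,Q::=L\mid[A_1,\dots,A_n]$ (finite multiset, $n\ge0$); types $A,B::=P\mid P\multimap A$. A typing context is a total map from variables to positive types with all but finitely many variables mapped to $[]$ (so $x:[]$ may be omitted); it is split into its ground part $\Lambda$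 (variables mapped to ground types) and its multiset part $\Gamma$ (variables mapped to multisets); a ground context is one consisting of its ground part only. $\uplus$ is multiset union, pointwise on multiset contexts. $\mathrm{Nm}(\cdot)$ is the set of names occurring. Rules (premises $\Longrightarrow$ conclusion): - (i-sample) $\Lambda\vdash\mathsf{sample}_d:X$ if $X\notin\mathrm{Nm}(\Lambda)$. - (i-cond) $\Lambda,y_1:Y_1,\dots,y_n:Y_n\vdash\mathsf c\langle y_1,\dots,y_n\rangle:X$ if $X\notin\{Y_1,\dots,Y_n\}$ and $X\notin\mathrm{Nm}(\Lambda)$. - (i-var) $\Lambda,x:P\vdash x:P$. - (i-let) $\Lambda,\Gamma_1\vdash u:P$ and $\Lambda,\Gamma_2,x:P\vdash t:A$ $\Longrightarrow$ $\Lambda,\Gamma_1\uplus\Gamma_2\vdash\mathsf{let}\ x=u\ \mathsf{in}\ t:A$. - (i-pair) $\Lambda\vdash v:L_1$ and $\Lambda\vdash w:L_2$ $\Longrightarrow$ $\Lambda\vdash\langle v,w\rangle:L_1\otimes L_2$. - (i-letp) $\Lambda\vdash v:L_1\otimes L_2$ and $\Lambda,x:L_1,y:L_2,\Gamma\vdash t:A$ $\Longrightarrow$ $\Lambda,\Gamma\vdash\mathsf{letp}\ \langle x,y\rangle=v\ \mathsf{in}\ t:A$. - (i-abs) $\Lambda,\Gamma,x:P\vdash t:A$ $\Longrightarrow$ $\Lambda,\Gamma\vdash\lambda x.t:P\multimap A$. - (i-app) $\Lambda,\Gamma_1\vdash t:P\multimap A$ and $\Lambda,\Gamma_2\vdash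 v:P$ $\Longrightarrow$ $\Lambda,\Gamma_1\uplus\Gamma_2\vdash t\,v:A$. - (i-bang) $(\Lambda,\Gamma_i\vdash t:A_i)_{i=1}^n$, $n\ge0$ $\Longrightarrow$ $\Lambda,\biguplus_i\Gamma_i\vdash\,!t:[A_1,\dots,A_n]$. - (i-der) $\Lambda,\Gamma\vdash v:[A]$ $\Longrightarrow$ $\Lambda,\Gamma\vdash\mathsf{der}\,v:A$. Naming condition (part of the definition of a derivation): the names $X$ typing the subjects of the (i-sample) and (i-cond) axioms of a derivation (its *main names*) are pairwise distinct.
   Formalization: Evaluation contexts get the extra clause letp ⟨x,y⟩=v in E (without it letp ⟨x,y⟩=z in let a=!sample_d in sample_d, z:X⊗Y, is a counterexample), and obs(v=b) is allowed for any value v so that substitution is defined; low-level terms keep obs on variables. -}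

module Defs where

open import Level using (Level; _⊔_) renaming (suc to lsuc)
open import Algebra.Bundles using (CommutativeRing)
open import Data.Bool.Base using (Bool; true; false)
open import Data.Fin.Base using (Fin; zero; suc)
open import Data.List.Base as List using (List; []; _∷_; _++_)
open import Data.List.Membership.Propositional using (_∉_)
import Data.List.Relation.Binary.Permutation.Homogeneous as Homogeneous
open import Data.List.Relation.Binary.Permutation.Propositional using (_↭_)
open import Data.List.Relation.Unary.Unique.Propositional using (Unique)
open import Data.Nat.Base using (ℕ; zero; suc)
open import Data.Product.Base using (_×_; _,_; Σ-syntax; ∃-syntax)
open import Data.Vec.Base as Vec using (Vec; []; _∷_; lookup; _[_]≔_)
open import Data.Vec.Relation.Binary.Pointwise.Inductive using (Pointwise)
open import Data.Vec.Relation.Unary.All using (All)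
open import Relation.Binary.Construct.Closure.ReflexiveTransitive using (Star)
open import Relation.Binary.Core using (Rel)
open import Relation.Binary.PropositionalEquality.Core using (_≡_)
open import Relation.Binary.Structures using (IsPartialOrder)
open import Relation.Nullary.Negation.Core using (¬_)

------------------------------------------------------------------------
-- Intersection types

Name : Set
Name = ℕ

data GroundTy : Set where
  name : Name → GroundTy
  _⊗_  : GroundTy → GroundTy → GroundTy

mutual
  data PosTy : Set where
    ground : GroundTy → PosTy
    mset   : List Ty → PosTy

  data Ty : Set where
    pos : PosTy → Ty
    _⊸_ : PosTy → Ty → Ty

-- Lists stand for finite multisets, so types are taken up to reordering
-- of these lists at every depth; typing is closed under _≈_ by i-conv.

mutual
  data _≈ᴾ_ : Rel PosTy Level.zero where
    ground : ∀ {L} → ground L ≈ᴾ ground L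
    mset   : ∀ {As Bs} → Homogeneous.Permutation _≈_ As Bs →
             mset As ≈ᴾ mset Bs

  data _≈_ : Rel Ty Level.zero where
    pos : ∀ {P Q} → P ≈ᴾ Q → pos P ≈ pos Q
    _⊸_ : ∀ {P Q A B} → P ≈ᴾ Q → A ≈ B → (P ⊸ A) ≈ (Q ⊸ B)

------------------------------------------------------------------------
-- Typing contexts

-- Variables are de Bruijn indices below n; those out of scope have type [].

Ctx : ℕ → Set
Ctx n = Vec PosTy n

_≈ᶜ_ : ∀ {n} → Rel (Ctx n) Level.zero
_≈ᶜ_ = Pointwise _≈ᴾ_

data NoMultiset : PosTy → Set where
  ground : ∀ {L} → NoMultiset (ground L)
  empty  : NoMultiset (mset [])

GroundCtx : ∀ {n} → Ctx n → Set
GroundCtx = All NoMultiset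

groundPartᴾ : PosTy → PosTy
groundPartᴾ (ground L) = ground L
groundPartᴾ (mset _)   = mset []

groundPart : ∀ {n} → Ctx n → Ctx n
groundPart = Vec.map groundPartᴾ

-- Γ₁ ⊎ Γ₂ ≔ Γ : the three contexts have the same ground part, and the
-- multiset part of Γ is the union of those of Γ₁ and Γ₂.

data _⊎ᴾ_≔_ : PosTy → PosTy → PosTy → Set where
  ground : ∀ {L} → ground L ⊎ᴾ ground L ≔ ground L
  mset   : ∀ {As Bs} → mset As ⊎ᴾ mset Bs ≔ mset (As ++ Bs)

data _⊎_≔_ : ∀ {n} → Ctx n → Ctx n → Ctx n → Set where
  []  : [] ⊎ [] ≔ []
  _∷_ : ∀ {n P₁ P₂ P} {Γ₁ Γ₂ Γ : Ctx n} →
        P₁ ⊎ᴾ P₂ ≔ P → Γ₁ ⊎ Γ₂ ≔ Γ → (P₁ ∷ Γ₁) ⊎ (P₂ ∷ Γ₂) ≔ (P ∷ Γ)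

namesᴳ : GroundTy → List Name
namesᴳ (name X) = X ∷ []
namesᴳ (K ⊗ L)  = namesᴳ K ++ namesᴳ L

-- Nm(Λ) for the ground part Λ of a context.

Nm : ∀ {n} → Ctx n → List Name
Nm []             = []
Nm (ground L ∷ Γ) = namesᴳ L ++ Nm Γ
Nm (mset _ ∷ Γ)   = Nm Γ

------------------------------------------------------------------------
-- Probabilities

-- There are no real numbers in the library. Probabilities are taken in an
-- arbitrary partially ordered commutative ring, of which ℝ is an instance.

record OrderedRing (c ℓ₁ ℓ₂ : Level) : Set (lsuc (c ⊔ ℓ₁ ⊔ ℓ₂)) where
  infix 4 _≤_
  field
    commutativeRing : CommutativeRing c ℓ₁
  open CommutativeRing commutativeRing public
    renaming (_≈_ to _≈ᴿ_)
  field
    _≤_            : Rel Carrier ℓ₂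
    isPartialOrder : IsPartialOrder _≈ᴿ_ _≤_
    +-monoˡ-≤      : ∀ {x y} z → x ≤ y → (x + z) ≤ (y + z)
    *-nonNeg       : ∀ {x y} → 0# ≤ x → 0# ≤ y → 0# ≤ (x * y)
    0≤1            : 0# ≤ 1#

module Calculus {c ℓ₁ ℓ₂ : Level} (R : OrderedRing c ℓ₁ ℓ₂) where

  private
    module R = OrderedRing R
    ℓ : Level
    ℓ = c ⊔ ℓ₁ ⊔ ℓ₂

  record Dist : Set ℓ where
    field
      prob   : Bool → R.Carrier
      nonNeg : ∀ b → R.0# R.≤ prob b
      total  : (prob true R.+ prob false) R.≈ᴿ R.1#

  ----------------------------------------------------------------------
  -- Terms

  -- Tm n and Val n have their free variables among n de Bruijn indices.
  --
  -- obs takes a value: on variables alone, substituting a pair, a bang or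
  -- a boolean would take a term out of the syntax. LowLevel below admits
  -- obs on variables only.
  --
  -- In letp v t, index 0 of t is the second component, index 1 the first.

  mutual
    data Tm (n : ℕ) : Set ℓ where
      val    : Val n → Tm n
      sample : Dist → Tm n
      case   : Val n → List (Val n × Dist) → Tm n
      obs    : Val n → Bool → Tm n
      let′   : Tm n → Tm (suc n) → Tm n
      letp   : Val n → Tm (suc (suc n)) → Tm n
      app    : Tm n → Val n → Tm n
      lam    : Tm (suc n) → Tm n
      der    : Val n → Tm n

    data Val (n : ℕ) : Set ℓ where
      var  : Fin n → Val n
      pair : Val n → Val n → Val n
      bang : Tm n → Val n
      bool : Bool → Val n

  tuple : ∀ {n k} → Vec (Val n) (suc k) → Val n
  tuple (v ∷ [])     = v
  tuple (v ∷ w ∷ vs) = pair v (tuple (w ∷ vs))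

  bitstrings : ∀ k → List (Vec Bool k)
  bitstrings zero    = [] ∷ []
  bitstrings (suc k) = List.map (true ∷_) (bitstrings k) ++
                       List.map (false ∷_) (bitstrings k)

  -- The family { b̄ ⇒ sample d_b̄ } over all b̄ ∈ {t,f}ᵏ⁺¹. As the family is
  -- unordered, it is used below up to permutation.

  table : ∀ {n k} → (Vec Bool (suc k) → Dist) → List (Val n × Dist)
  table {k = k} d =
    List.map (λ bs → tuple (Vec.map bool bs) , d bs) (bitstrings (suc k))

  data LowLevelVal {n : ℕ} : Val n → Set ℓ where
    var  : ∀ x → LowLevelVal (var x)
    pair : ∀ {v w} → LowLevelVal v → LowLevelVal w → LowLevelVal (pair v w)
    bool : ∀ b → LowLevelVal (bool b)

  data LowLevel {n : ℕ} : Tm n → Set ℓ where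
    val    : ∀ {v} → LowLevelVal v → LowLevel (val v)
    sample : ∀ d → LowLevel (sample d)
    case   : ∀ {v bs k} (d : Vec Bool (suc k) → Dist) →
             LowLevelVal v → bs ↭ table d → LowLevel (case v bs)
    obs    : ∀ x b → LowLevel (obs (var x) b)
    let′   : ∀ {u t} → LowLevel u → LowLevel t → LowLevel (let′ u t)
    letp   : ∀ {v t} → LowLevelVal v → LowLevel t → LowLevel (letp v t)

  ----------------------------------------------------------------------
  -- Substitution

  Ren : ℕ → ℕ → Set
  Ren m n = Fin m → Fin n

  extᴿ : ∀ {m n} → Ren m n → Ren (suc m) (suc n)
  extᴿ ρ zero    = zero
  extᴿ ρ (suc x) = suc (ρ x)

  mutual
    ren : ∀ {m n} → Ren m n → Tm m → Tm n
    ren ρ (val v)     = val (renᵛ ρ v)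
    ren ρ (sample d)  = sample d
    ren ρ (case v bs) = case (renᵛ ρ v) (renᵇ ρ bs)
    ren ρ (obs v b)   = obs (renᵛ ρ v) b
    ren ρ (let′ u t)  = let′ (ren ρ u) (ren (extᴿ ρ) t)
    ren ρ (letp v t)  = letp (renᵛ ρ v) (ren (extᴿ (extᴿ ρ)) t)
    ren ρ (app t v)   = app (ren ρ t) (renᵛ ρ v)
    ren ρ (lam t)     = lam (ren (extᴿ ρ) t)
    ren ρ (der v)     = der (renᵛ ρ v)

    renᵛ : ∀ {m n} → Ren m n → Val m → Val n
    renᵛ ρ (var x)    = var (ρ x)
    renᵛ ρ (pair v w) = pair (renᵛ ρ v) (renᵛ ρ w)
    renᵛ ρ (bang t)   = bang (ren ρ t)
    renᵛ ρ (bool b)   = bool b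

    renᵇ : ∀ {m n} → Ren m n → List (Val m × Dist) → List (Val n × Dist)
    renᵇ ρ []             = []
    renᵇ ρ ((v , d) ∷ bs) = (renᵛ ρ v , d) ∷ renᵇ ρ bs

  Sub : ℕ → ℕ → Set ℓ
  Sub m n = Fin m → Val n

  ext : ∀ {m n} → Sub m n → Sub (suc m) (suc n)
  ext σ zero    = var zero
  ext σ (suc x) = renᵛ suc (σ x)

  mutual
    sub : ∀ {m n} → Sub m n → Tm m → Tm n
    sub σ (val v)     = val (subᵛ σ v)
    sub σ (sample d)  = sample d
    sub σ (case v bs) = case (subᵛ σ v) (subᵇ σ bs)
    sub σ (obs v b)   = obs (subᵛ σ v) b
    sub σ (let′ u t)  = let′ (sub σ u) (sub (ext σ) t)
    sub σ (letp v t)  = letp (subᵛ σ v) (sub (ext (ext σ)) t)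
    sub σ (app t v)   = app (sub σ t) (subᵛ σ v)
    sub σ (lam t)     = lam (sub (ext σ) t)
    sub σ (der v)     = der (subᵛ σ v)

    subᵛ : ∀ {m n} → Sub m n → Val m → Val n
    subᵛ σ (var x)    = σ x
    subᵛ σ (pair v w) = pair (subᵛ σ v) (subᵛ σ w)
    subᵛ σ (bang t)   = bang (sub σ t)
    subᵛ σ (bool b)   = bool b

    subᵇ : ∀ {m n} → Sub m n → List (Val m × Dist) → List (Val n × Dist)
    subᵇ σ []             = []
    subᵇ σ ((v , d) ∷ bs) = (subᵛ σ v , d) ∷ subᵇ σ bs

  _•_ : ∀ {m n} → Val n → Sub m n → Sub (suc m) n
  (v • σ) zero    = v
  (v • σ) (suc x) = σ x

  _[_] : ∀ {n} → Tm (suc n) → Val n → Tm n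
  t [ v ] = sub (v • var) t

  ----------------------------------------------------------------------
  -- Reduction

  -- SubstList n m : outer scope n, scope m at the hole.

  data SubstList (n : ℕ) : ℕ → Set ℓ where
    hole : SubstList n n
    let′ : ∀ {m} → Tm n → SubstList (suc n) m → SubstList n m
    letp : ∀ {m} → Val n → SubstList (suc (suc n)) m → SubstList n m

  ⟪_⟫_ : ∀ {n m} → Tm m → SubstList n m → Tm n
  ⟪ t ⟫ hole     = t
  ⟪ t ⟫ let′ u S = let′ u (⟪ t ⟫ S)
  ⟪ t ⟫ letp v S = letp v (⟪ t ⟫ S)

  weaken : ∀ {n m} → SubstList n m → Ren n m
  weaken hole       x = x
  weaken (let′ _ S) x = weaken S (suc x)
  weaken (letp _ S) x = weaken S (suc (suc x))

  infix 4 _↦_ _⟶_ _⟶*_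

  data _↦_ {n : ℕ} : Tm n → Tm n → Set ℓ where
    β-lam  : ∀ {m} (S : SubstList n m) t v →
             app (⟪ lam t ⟫ S) v ↦ ⟪ t [ renᵛ (weaken S) v ] ⟫ S
    β-let  : ∀ {m} (S : SubstList n m) v t →
             let′ (⟪ val v ⟫ S) t ↦ ⟪ ren (extᴿ (weaken S)) t [ v ] ⟫ S
    β-der  : ∀ t → der (bang t) ↦ t
    β-letp : ∀ v w t → letp (pair v w) t ↦ sub (w • (v • var)) t

  -- Closure under the evaluation contexts
  --   E ::= (·) | E v | let x = E in t | let x = u in E
  --       | letp ⟨x,y⟩ = v in E.
  -- Without the last clause, letp ⟨x,y⟩ = z in let a = !t in sample_d with
  -- z : X ⊗ Y would be typable at a name, irreducible and not low-level.

  data _⟶_ : ∀ {n} → Tm n → Tm n → Set ℓ where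
    root   : ∀ {n} {t t′ : Tm n} → t ↦ t′ → t ⟶ t′
    E-app  : ∀ {n} {t t′ : Tm n} {v} → t ⟶ t′ → app t v ⟶ app t′ v
    E-let₁ : ∀ {n} {u u′ : Tm n} {t} → u ⟶ u′ → let′ u t ⟶ let′ u′ t
    E-let₂ : ∀ {n u} {t t′ : Tm (suc n)} → t ⟶ t′ → let′ u t ⟶ let′ u t′
    E-letp : ∀ {n v} {t t′ : Tm (suc (suc n))} → t ⟶ t′ → letp v t ⟶ letp v t′

  _⟶*_ : ∀ {n} → Rel (Tm n) ℓ
  _⟶*_ = Star _⟶_

  Normal : ∀ {n} → Tm n → Set ℓ
  Normal u = ¬ (∃[ u′ ] u ⟶ u′)

  ----------------------------------------------------------------------
  -- Typing

  -- A judgement Λ ⊢ … with no multiset part is rendered by GroundCtx.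

  infix 3 _⊢_∶_ _⊢!_∶_

  mutual
    data _⊢_∶_ {n : ℕ} : Ctx n → Tm n → Ty → Set ℓ where
      i-sample : ∀ {Λ d X} → GroundCtx Λ → X ∉ Nm Λ →
                 Λ ⊢ sample d ∶ pos (ground (name X))

      -- Λ is the whole context, the variables ys included: X ∉ Nm Λ also
      -- excludes X from the names Ys.
      i-cond   : ∀ {Λ X k bs} (ys : Vec (Fin n) (suc k)) (Ys : Vec Name (suc k))
                 (d : Vec Bool (suc k) → Dist) →
                 GroundCtx Λ →
                 (∀ i → lookup Λ (lookup ys i) ≡ ground (name (lookup Ys i))) →
                 bs ↭ table d → X ∉ Nm Λ →
                 Λ ⊢ case (tuple (Vec.map var ys)) bs ∶ pos (ground (name X))

      i-var    : ∀ {Γ x P} → lookup Γ x ≡ P → GroundCtx (Γ [ x ]≔ mset []) →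
                 Γ ⊢ val (var x) ∶ pos P

      i-let    : ∀ {Γ₁ Γ₂ Γ u t P A} → Γ₁ ⊎ Γ₂ ≔ Γ →
                 Γ₁ ⊢ u ∶ pos P → (P ∷ Γ₂) ⊢ t ∶ A →
                 Γ ⊢ let′ u t ∶ A

      i-pair   : ∀ {Λ v w L₁ L₂} → GroundCtx Λ →
                 Λ ⊢ val v ∶ pos (ground L₁) → Λ ⊢ val w ∶ pos (ground L₂) →
                 Λ ⊢ val (pair v w) ∶ pos (ground (L₁ ⊗ L₂))

      i-letp   : ∀ {Γ v t L₁ L₂ A} →
                 groundPart Γ ⊢ val v ∶ pos (ground (L₁ ⊗ L₂)) →
                 (ground L₂ ∷ ground L₁ ∷ Γ) ⊢ t ∶ A →
                 Γ ⊢ letp v t ∶ A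

      i-abs    : ∀ {Γ t P A} → (P ∷ Γ) ⊢ t ∶ A → Γ ⊢ lam t ∶ (P ⊸ A)

      i-app    : ∀ {Γ₁ Γ₂ Γ t v P A} → Γ₁ ⊎ Γ₂ ≔ Γ →
                 Γ₁ ⊢ t ∶ (P ⊸ A) → Γ₂ ⊢ val v ∶ pos P →
                 Γ ⊢ app t v ∶ A

      i-bang   : ∀ {Γ t As} → Γ ⊢! t ∶ As → Γ ⊢ val (bang t) ∶ pos (mset As)

      i-der    : ∀ {Γ v A} → Γ ⊢ val v ∶ pos (mset (A ∷ [])) → Γ ⊢ der v ∶ A

      i-conv   : ∀ {Γ Γ′ t A A′} → Γ ≈ᶜ Γ′ → A ≈ A′ → Γ ⊢ t ∶ A → Γ′ ⊢ t ∶ A′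

    -- The premises of i-bang, with the union of their contexts.
    data _⊢!_∶_ {n : ℕ} : Ctx n → Tm n → List Ty → Set ℓ where
      []  : ∀ {Λ t} → GroundCtx Λ → Λ ⊢! t ∶ []
      add : ∀ {Γ₁ Γ₂ Γ t A As} → Γ₁ ⊎ Γ₂ ≔ Γ →
            Γ₁ ⊢ t ∶ A → Γ₂ ⊢! t ∶ As → Γ ⊢! t ∶ (A ∷ As)

  mutual
    mainNames : ∀ {n} {Γ : Ctx n} {t A} → Γ ⊢ t ∶ A → List Name
    mainNames (i-sample {X = X} _ _)         = X ∷ []
    mainNames (i-cond {X = X} _ _ _ _ _ _ _) = X ∷ []
    mainNames (i-var _ _)                    = []
    mainNames (i-let _ D₁ D₂)                = mainNames D₁ ++ mainNames D₂
    mainNames (i-pair _ D₁ D₂)               = mainNames D₁ ++ mainNames D₂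
    mainNames (i-letp D₁ D₂)                 = mainNames D₁ ++ mainNames D₂
    mainNames (i-abs D)                      = mainNames D
    mainNames (i-app _ D₁ D₂)                = mainNames D₁ ++ mainNames D₂
    mainNames (i-bang Ds)                    = mainNames! Ds
    mainNames (i-der D)                      = mainNames D
    mainNames (i-conv _ _ D)                 = mainNames D

    mainNames! : ∀ {n} {Γ : Ctx n} {t As} → Γ ⊢! t ∶ As → List Name
    mainNames! ([] _)       = []
    mainNames! (add _ D Ds) = mainNames D ++ mainNames! Ds

  Derivable : ∀ {n} → Ctx n → Tm n → Ty → Set ℓ
  Derivable Γ t A = Σ[ D ∈ (Γ ⊢ t ∶ A) ] Unique (mainNames D)

{-# OPTIONS --safe #-}
module Submission where

-- The proof interprets types as predicates on terms (reducibility): an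
-- inhabitant of A reduces to an answer ⟪ r ⟫ S, where S is a frozen
-- substitution list binding only stuck computations and r is a canonical
-- inhabitant of A. Ground values are the low-level values, and a value of type
-- [A₁,…,Aₙ] is a bang whose body inhabits every Aᵢ (any value at all if n = 0).
-- Multiplicities and names play no role.

open import Defs
open import Level using (Level; _⊔_)
open import Data.Bool.Base using (Bool)
open import Data.Fin.Base using (Fin; zero; suc)
open import Data.List.Base as List using (List; []; _∷_; _++_)
import Data.List.Properties as List
import Data.List.Relation.Binary.Permutation.Homogeneous as Homogeneous
open import Data.List.Relation.Binary.Permutation.Propositional
  using (_↭_; ↭-trans; ↭-reflexive)
open import Data.List.Relation.Binary.Permutation.Propositional.Properties
  using (map⁺)
open import Data.List.Relation.Binary.Pointwise.Base using (Pointwise; []; _∷_)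
open import Data.Nat.Base using (ℕ; suc)
open import Data.Product.Base using (_×_; _,_; proj₁; proj₂; ∃-syntax; map₁; map₂)
open import Data.Sum.Base as Sum using (_⊎_; inj₁; inj₂)
open import Data.Unit.Polymorphic.Base using (⊤; tt)
open import Data.Vec.Base as Vec using (Vec; []; _∷_; lookup)
open import Data.Vec.Relation.Binary.Pointwise.Inductive using ([]; _∷_)
open import Data.Vec.Relation.Unary.All.Properties using (lookup⁺)
open import Function.Base using (_∘_; id)
open import Function.Bundles using (_⇔_; mk⇔; Equivalence)
open import Relation.Binary.Construct.Closure.ReflexiveTransitive
  using (ε; _◅_; _◅◅_; gmap)
open import Relation.Binary.PropositionalEquality
  using (_≡_; refl; sym; trans; cong; cong₂; subst; _≗_; module ≡-Reasoning)
open import Relation.Nullary.Negation.Core using (¬_)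

open Equivalence using (to; from)

module Normalisation {c ℓ₁ ℓ₂ : Level} (R : OrderedRing c ℓ₁ ℓ₂) where

  open Calculus R

  private
    ℓ : Level
    ℓ = c ⊔ ℓ₁ ⊔ ℓ₂

    variable
      k l m n : ℕ

  -- Fusion laws of renaming and substitution

  extᴿ-extᴿ : {ρ₁ : Ren l m} {ρ₂ : Ren m n} {ρ₃ : Ren l n} →
              ρ₂ ∘ ρ₁ ≗ ρ₃ → extᴿ ρ₂ ∘ extᴿ ρ₁ ≗ extᴿ ρ₃
  extᴿ-extᴿ eq zero    = refl
  extᴿ-extᴿ eq (suc x) = cong suc (eq x)

  mutual
    -- The composite is a separate renaming `ρ₃`, related to `ρ₂ ∘ ρ₁` only pointwise. Under a
    -- binder, extending a composite and composing the extensions agree pointwise, so the hypothesis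
    -- passes through the induction without function extensionality. The later fusion laws have the
    -- same form.
    ren-ren : {ρ₁ : Ren l m} {ρ₂ : Ren m n} {ρ₃ : Ren l n} →
              ρ₂ ∘ ρ₁ ≗ ρ₃ → ren ρ₂ ∘ ren ρ₁ ≗ ren ρ₃
    ren-ren eq (val v)     = cong val (renᵛ-renᵛ eq v)
    ren-ren eq (sample d)  = refl
    ren-ren eq (case v bs) = cong₂ case (renᵛ-renᵛ eq v) (renᵇ-renᵇ eq bs)
    ren-ren eq (obs v b)   = cong (λ w → obs w b) (renᵛ-renᵛ eq v)
    ren-ren eq (let′ u t)  = cong₂ let′ (ren-ren eq u) (ren-ren (extᴿ-extᴿ eq) t)
    ren-ren eq (letp v t)  =
      cong₂ letp (renᵛ-renᵛ eq v) (ren-ren (extᴿ-extᴿ (extᴿ-extᴿ eq)) t)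
    ren-ren eq (app t v)   = cong₂ app (ren-ren eq t) (renᵛ-renᵛ eq v)
    ren-ren eq (lam t)     = cong lam (ren-ren (extᴿ-extᴿ eq) t)
    ren-ren eq (der v)     = cong der (renᵛ-renᵛ eq v)

    renᵛ-renᵛ : {ρ₁ : Ren l m} {ρ₂ : Ren m n} {ρ₃ : Ren l n} →
                ρ₂ ∘ ρ₁ ≗ ρ₃ → renᵛ ρ₂ ∘ renᵛ ρ₁ ≗ renᵛ ρ₃
    renᵛ-renᵛ eq (var x)    = cong var (eq x)
    renᵛ-renᵛ eq (pair v w) = cong₂ pair (renᵛ-renᵛ eq v) (renᵛ-renᵛ eq w)
    renᵛ-renᵛ eq (bang t)   = cong bang (ren-ren eq t)
    renᵛ-renᵛ eq (bool b)   = refl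

    renᵇ-renᵇ : {ρ₁ : Ren l m} {ρ₂ : Ren m n} {ρ₃ : Ren l n} →
                ρ₂ ∘ ρ₁ ≗ ρ₃ → renᵇ ρ₂ ∘ renᵇ ρ₁ ≗ renᵇ ρ₃
    renᵇ-renᵇ eq []             = refl
    renᵇ-renᵇ eq ((v , d) ∷ bs) =
      cong₂ _∷_ (cong (_, d) (renᵛ-renᵛ eq v)) (renᵇ-renᵇ eq bs)

  ext-extᴿ : {ρ : Ren l m} {σ : Sub m n} {τ : Sub l n} →
             σ ∘ ρ ≗ τ → ext σ ∘ extᴿ ρ ≗ ext τ
  ext-extᴿ eq zero    = refl
  ext-extᴿ eq (suc x) = cong (renᵛ suc) (eq x)

  mutual
    sub-ren : {ρ : Ren l m} {σ : Sub m n} {τ : Sub l n} →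
              σ ∘ ρ ≗ τ → sub σ ∘ ren ρ ≗ sub τ
    sub-ren eq (val v)     = cong val (subᵛ-renᵛ eq v)
    sub-ren eq (sample d)  = refl
    sub-ren eq (case v bs) = cong₂ case (subᵛ-renᵛ eq v) (subᵇ-renᵇ eq bs)
    sub-ren eq (obs v b)   = cong (λ w → obs w b) (subᵛ-renᵛ eq v)
    sub-ren eq (let′ u t)  = cong₂ let′ (sub-ren eq u) (sub-ren (ext-extᴿ eq) t)
    sub-ren eq (letp v t)  =
      cong₂ letp (subᵛ-renᵛ eq v) (sub-ren (ext-extᴿ (ext-extᴿ eq)) t)
    sub-ren eq (app t v)   = cong₂ app (sub-ren eq t) (subᵛ-renᵛ eq v)
    sub-ren eq (lam t)     = cong lam (sub-ren (ext-extᴿ eq) t)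
    sub-ren eq (der v)     = cong der (subᵛ-renᵛ eq v)

    subᵛ-renᵛ : {ρ : Ren l m} {σ : Sub m n} {τ : Sub l n} →
                σ ∘ ρ ≗ τ → subᵛ σ ∘ renᵛ ρ ≗ subᵛ τ
    subᵛ-renᵛ eq (var x)    = eq x
    subᵛ-renᵛ eq (pair v w) = cong₂ pair (subᵛ-renᵛ eq v) (subᵛ-renᵛ eq w)
    subᵛ-renᵛ eq (bang t)   = cong bang (sub-ren eq t)
    subᵛ-renᵛ eq (bool b)   = refl

    subᵇ-renᵇ : {ρ : Ren l m} {σ : Sub m n} {τ : Sub l n} →
                σ ∘ ρ ≗ τ → subᵇ σ ∘ renᵇ ρ ≗ subᵇ τ
    subᵇ-renᵇ eq []             = refl
    subᵇ-renᵇ eq ((v , d) ∷ bs) =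
      cong₂ _∷_ (cong (_, d) (subᵛ-renᵛ eq v)) (subᵇ-renᵇ eq bs)

  renᵛ-suc : (ρ : Ren m n) → renᵛ (extᴿ ρ) ∘ renᵛ suc ≗ renᵛ suc ∘ renᵛ ρ
  renᵛ-suc ρ v = trans (renᵛ-renᵛ (λ _ → refl) v) (sym (renᵛ-renᵛ (λ _ → refl) v))

  extᴿ-ext : {σ : Sub l m} {ρ : Ren m n} {τ : Sub l n} →
             renᵛ ρ ∘ σ ≗ τ → renᵛ (extᴿ ρ) ∘ ext σ ≗ ext τ
  extᴿ-ext eq zero = refl
  extᴿ-ext {σ = σ} {ρ} eq (suc x) =
    trans (renᵛ-suc ρ (σ x)) (cong (renᵛ suc) (eq x))

  mutual
    ren-sub : {σ : Sub l m} {ρ : Ren m n} {τ : Sub l n} →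
              renᵛ ρ ∘ σ ≗ τ → ren ρ ∘ sub σ ≗ sub τ
    ren-sub eq (val v)     = cong val (renᵛ-subᵛ eq v)
    ren-sub eq (sample d)  = refl
    ren-sub eq (case v bs) = cong₂ case (renᵛ-subᵛ eq v) (renᵇ-subᵇ eq bs)
    ren-sub eq (obs v b)   = cong (λ w → obs w b) (renᵛ-subᵛ eq v)
    ren-sub eq (let′ u t)  = cong₂ let′ (ren-sub eq u) (ren-sub (extᴿ-ext eq) t)
    ren-sub eq (letp v t)  =
      cong₂ letp (renᵛ-subᵛ eq v) (ren-sub (extᴿ-ext (extᴿ-ext eq)) t)
    ren-sub eq (app t v)   = cong₂ app (ren-sub eq t) (renᵛ-subᵛ eq v)
    ren-sub eq (lam t)     = cong lam (ren-sub (extᴿ-ext eq) t)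
    ren-sub eq (der v)     = cong der (renᵛ-subᵛ eq v)

    renᵛ-subᵛ : {σ : Sub l m} {ρ : Ren m n} {τ : Sub l n} →
                renᵛ ρ ∘ σ ≗ τ → renᵛ ρ ∘ subᵛ σ ≗ subᵛ τ
    renᵛ-subᵛ eq (var x)    = eq x
    renᵛ-subᵛ eq (pair v w) = cong₂ pair (renᵛ-subᵛ eq v) (renᵛ-subᵛ eq w)
    renᵛ-subᵛ eq (bang t)   = cong bang (ren-sub eq t)
    renᵛ-subᵛ eq (bool b)   = refl

    renᵇ-subᵇ : {σ : Sub l m} {ρ : Ren m n} {τ : Sub l n} →
                renᵛ ρ ∘ σ ≗ τ → renᵇ ρ ∘ subᵇ σ ≗ subᵇ τ
    renᵇ-subᵇ eq []             = refl
    renᵇ-subᵇ eq ((v , d) ∷ bs) =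
      cong₂ _∷_ (cong (_, d) (renᵛ-subᵛ eq v)) (renᵇ-subᵇ eq bs)

  subᵛ-suc : (σ : Sub m n) → subᵛ (ext σ) ∘ renᵛ suc ≗ renᵛ suc ∘ subᵛ σ
  subᵛ-suc σ v = trans (subᵛ-renᵛ (λ _ → refl) v) (sym (renᵛ-subᵛ (λ _ → refl) v))

  ext-ext : {σ : Sub l m} {τ : Sub m n} {υ : Sub l n} →
            subᵛ τ ∘ σ ≗ υ → subᵛ (ext τ) ∘ ext σ ≗ ext υ
  ext-ext eq zero = refl
  ext-ext {σ = σ} {τ} eq (suc x) =
    trans (subᵛ-suc τ (σ x)) (cong (renᵛ suc) (eq x))

  mutual
    -- Last of the four laws: its binder case rests on `subᵛ-suc`, which combines the two mixed laws
    -- `subᵛ-renᵛ` and `renᵛ-subᵛ`.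
    sub-sub : {σ : Sub l m} {τ : Sub m n} {υ : Sub l n} →
              subᵛ τ ∘ σ ≗ υ → sub τ ∘ sub σ ≗ sub υ
    sub-sub eq (val v)     = cong val (subᵛ-subᵛ eq v)
    sub-sub eq (sample d)  = refl
    sub-sub eq (case v bs) = cong₂ case (subᵛ-subᵛ eq v) (subᵇ-subᵇ eq bs)
    sub-sub eq (obs v b)   = cong (λ w → obs w b) (subᵛ-subᵛ eq v)
    sub-sub eq (let′ u t)  = cong₂ let′ (sub-sub eq u) (sub-sub (ext-ext eq) t)
    sub-sub eq (letp v t)  =
      cong₂ letp (subᵛ-subᵛ eq v) (sub-sub (ext-ext (ext-ext eq)) t)
    sub-sub eq (app t v)   = cong₂ app (sub-sub eq t) (subᵛ-subᵛ eq v)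
    sub-sub eq (lam t)     = cong lam (sub-sub (ext-ext eq) t)
    sub-sub eq (der v)     = cong der (subᵛ-subᵛ eq v)

    subᵛ-subᵛ : {σ : Sub l m} {τ : Sub m n} {υ : Sub l n} →
                subᵛ τ ∘ σ ≗ υ → subᵛ τ ∘ subᵛ σ ≗ subᵛ υ
    subᵛ-subᵛ eq (var x)    = eq x
    subᵛ-subᵛ eq (pair v w) = cong₂ pair (subᵛ-subᵛ eq v) (subᵛ-subᵛ eq w)
    subᵛ-subᵛ eq (bang t)   = cong bang (sub-sub eq t)
    subᵛ-subᵛ eq (bool b)   = refl

    subᵇ-subᵇ : {σ : Sub l m} {τ : Sub m n} {υ : Sub l n} →
                subᵛ τ ∘ σ ≗ υ → subᵇ τ ∘ subᵇ σ ≗ subᵇ υ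
    subᵇ-subᵇ eq []             = refl
    subᵇ-subᵇ eq ((v , d) ∷ bs) =
      cong₂ _∷_ (cong (_, d) (subᵛ-subᵛ eq v)) (subᵇ-subᵇ eq bs)

  ext-var : {σ : Sub n n} → σ ≗ var → ext σ ≗ var
  ext-var eq zero    = refl
  ext-var eq (suc x) = cong (renᵛ suc) (eq x)

  mutual
    sub-id : {σ : Sub n n} → σ ≗ var → sub σ ≗ id
    sub-id eq (val v)     = cong val (subᵛ-id eq v)
    sub-id eq (sample d)  = refl
    sub-id eq (case v bs) = cong₂ case (subᵛ-id eq v) (subᵇ-id eq bs)
    sub-id eq (obs v b)   = cong (λ w → obs w b) (subᵛ-id eq v)
    sub-id eq (let′ u t)  = cong₂ let′ (sub-id eq u) (sub-id (ext-var eq) t)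
    sub-id eq (letp v t)  =
      cong₂ letp (subᵛ-id eq v) (sub-id (ext-var (ext-var eq)) t)
    sub-id eq (app t v)   = cong₂ app (sub-id eq t) (subᵛ-id eq v)
    sub-id eq (lam t)     = cong lam (sub-id (ext-var eq) t)
    sub-id eq (der v)     = cong der (subᵛ-id eq v)

    subᵛ-id : {σ : Sub n n} → σ ≗ var → subᵛ σ ≗ id
    subᵛ-id eq (var x)    = eq x
    subᵛ-id eq (pair v w) = cong₂ pair (subᵛ-id eq v) (subᵛ-id eq w)
    subᵛ-id eq (bang t)   = cong bang (sub-id eq t)
    subᵛ-id eq (bool b)   = refl

    subᵇ-id : {σ : Sub n n} → σ ≗ var → subᵇ σ ≗ id
    subᵇ-id eq []             = refl
    subᵇ-id eq ((v , d) ∷ bs) =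
      cong₂ _∷_ (cong (_, d) (subᵛ-id eq v)) (subᵇ-id eq bs)

  ren-id : (t : Tm n) → ren id t ≡ t
  ren-id t = begin
    ren id t           ≡⟨ cong (ren id) (sub-id (λ _ → refl) t) ⟨
    ren id (sub var t) ≡⟨ ren-sub (λ _ → refl) t ⟩
    sub var t          ≡⟨ sub-id (λ _ → refl) t ⟩
    t                  ∎
    where open ≡-Reasoning

  -- Contracta of the root rules as extended environments

  sub-ext-[] : (σ : Sub m n) (t : Tm (suc m)) (v : Val n) →
               sub (ext σ) t [ v ] ≡ sub (v • σ) t
  sub-ext-[] σ t v = sub-sub eq t
    where
    eq : subᵛ (v • var) ∘ ext σ ≗ v • σ
    eq zero    = refl
    eq (suc x) = trans (subᵛ-renᵛ (λ _ → refl) (σ x)) (subᵛ-id (λ _ → refl) (σ x))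

  -- Shape of the contractum of `β-let`, with `ρ` the weakening into the scope of the extruded
  -- substitution list: the old environment is renamed along `ρ` and extended by the bound value.
  ren-sub-ext-[] : (ρ : Ren m n) (σ : Sub l m) (t : Tm (suc l)) (v : Val n) →
                   ren (extᴿ ρ) (sub (ext σ) t) [ v ] ≡ sub (v • (renᵛ ρ ∘ σ)) t
  ren-sub-ext-[] ρ σ t v =
    trans (cong (_[ v ]) (ren-sub (extᴿ-ext (λ _ → refl)) t))
          (sub-ext-[] (renᵛ ρ ∘ σ) t v)

  sub-ext-ext-[] : (σ : Sub m n) (t : Tm (suc (suc m))) (v w : Val n) →
                   sub (w • (v • var)) (sub (ext (ext σ)) t) ≡ sub (w • (v • σ)) t
  sub-ext-ext-[] σ t v w = sub-sub eq t
    where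
    eq : subᵛ (w • (v • var)) ∘ ext (ext σ) ≗ w • (v • σ)
    eq zero          = refl
    eq (suc zero)    = refl
    eq (suc (suc x)) =
      trans (subᵛ-renᵛ (λ _ → refl) (renᵛ suc (σ x)))
            (trans (subᵛ-renᵛ (λ _ → refl) (σ x)) (subᵛ-id (λ _ → refl) (σ x)))

  -- Stability of low-level values and case tables

  renᵛ-lowLevel : {ρ : Ren m n} {v : Val m} → LowLevelVal v → LowLevelVal (renᵛ ρ v)
  renᵛ-lowLevel (var x)    = var _
  renᵛ-lowLevel (pair v w) = pair (renᵛ-lowLevel v) (renᵛ-lowLevel w)
  renᵛ-lowLevel (bool b)   = bool b

  subᵛ-tuple-bool : (σ : Sub m n) (bs : Vec Bool (suc k)) →
                    subᵛ σ (tuple (Vec.map bool bs)) ≡ tuple (Vec.map bool bs)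
  subᵛ-tuple-bool σ (b ∷ [])      = refl
  subᵛ-tuple-bool σ (b ∷ b′ ∷ bs) = cong (pair (bool b)) (subᵛ-tuple-bool σ (b′ ∷ bs))

  subᵇ-map : (σ : Sub m n) (bs : List (Val m × Dist)) →
             subᵇ σ bs ≡ List.map (map₁ (subᵛ σ)) bs
  subᵇ-map σ []             = refl
  subᵇ-map σ ((v , d) ∷ bs) = cong (_ ∷_) (subᵇ-map σ bs)

  -- The patterns of a table are closed tuples of booleans, which every substitution fixes; mapping
  -- over the branches preserves the permutation.
  subᵇ-table : (σ : Sub m n) (d : Vec Bool (suc k) → Dist) {bs : List (Val m × Dist)} →
               bs ↭ table d → subᵇ σ bs ↭ table d
  subᵇ-table {k = k} σ d {bs} p =
    ↭-trans (↭-reflexive (subᵇ-map σ bs))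
      (↭-trans (map⁺ (map₁ (subᵛ σ)) p) (↭-reflexive (begin
        List.map (map₁ (subᵛ σ)) (table d)
          ≡⟨ List.map-∘ (bitstrings (suc k)) ⟨
        List.map (λ bs → subᵛ σ (tuple (Vec.map bool bs)) , d bs) (bitstrings (suc k))
          ≡⟨ List.map-cong (λ bs → cong (_, d bs) (subᵛ-tuple-bool σ bs)) (bitstrings (suc k)) ⟩
        table d ∎)))
    where open ≡-Reasoning

  -- Answers

  -- The low-level values other than pairs, that is, those on which `β-letp` cannot fire.
  data Neutral {n} : Val n → Set ℓ where
    var  : ∀ x → Neutral (var x)
    bool : ∀ b → Neutral (bool b)

  -- Redex-free computations whose final position is a `sample` or a `case`, so that a `let′`
  -- binding one of them is not a `β-let` redex.
  data Stuck {n} : Tm n → Set ℓ where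
    sample : ∀ d → Stuck (sample d)
    case   : ∀ {v bs k} (d : Vec Bool (suc k) → Dist) →
             LowLevelVal v → bs ↭ table d → Stuck (case v bs)
    let′   : ∀ {u t} → Stuck u → Stuck t → Stuck (let′ u t)
    letp   : ∀ {v t} → Neutral v → Stuck t → Stuck (letp v t)

  data Frozen {n} : ∀ {m} → SubstList n m → Set ℓ where
    hole : Frozen hole
    let′ : ∀ {m u} {S : SubstList (suc n) m} → Stuck u → Frozen S → Frozen (let′ u S)
    letp : ∀ {m v} {S : SubstList (suc (suc n)) m} →
           Neutral v → Frozen S → Frozen (letp v S)

  neutral⇒lowLevel : {v : Val n} → Neutral v → LowLevelVal v
  neutral⇒lowLevel (var x)  = var x
  neutral⇒lowLevel (bool b) = bool b

  stuck⇒lowLevel : {t : Tm n} → Stuck t → LowLevel t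
  stuck⇒lowLevel (sample d)   = sample d
  stuck⇒lowLevel (case d v p) = case d v p
  stuck⇒lowLevel (let′ u t)   = let′ (stuck⇒lowLevel u) (stuck⇒lowLevel t)
  stuck⇒lowLevel (letp v t)   = letp (neutral⇒lowLevel v) (stuck⇒lowLevel t)

  -- Descending through the bodies of `let′` and `letp`, a stuck term ends in `sample` or `case`,
  -- the plugged list in a value. This excludes `β-let` at the root in `let-normal`.
  ¬stuck-val : {v : Val m} (S : SubstList n m) → ¬ Stuck (⟪ val v ⟫ S)
  ¬stuck-val (let′ u S) (let′ _ s) = ¬stuck-val S s
  ¬stuck-val (letp v S) (letp _ s) = ¬stuck-val S s

  val-normal : (v : Val n) → Normal (val v)
  val-normal v (_ , root ())

  let-normal : {u : Tm n} {t : Tm (suc n)} →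
               Stuck u → Normal u → Normal t → Normal (let′ u t)
  let-normal s nu nt (_ , root (β-let S v t)) = ¬stuck-val S s
  let-normal s nu nt (_ , E-let₁ r)           = nu (_ , r)
  let-normal s nu nt (_ , E-let₂ r)           = nt (_ , r)

  letp-normal : {v : Val n} {t : Tm (suc (suc n))} →
                Neutral v → Normal t → Normal (letp v t)
  letp-normal () nt (_ , root (β-letp v w t))
  letp-normal s  nt (_ , E-letp r) = nt (_ , r)

  stuck⇒normal : {t : Tm n} → Stuck t → Normal t
  stuck⇒normal (sample d)   (_ , root ())
  stuck⇒normal (case d v p) (_ , root ())
  stuck⇒normal (let′ u t)   = let-normal u (stuck⇒normal u) (stuck⇒normal t)
  stuck⇒normal (letp v t)   = letp-normal v (stuck⇒normal t)

  plug-lowLevel : {S : SubstList n m} {r : Tm m} →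
                  Frozen S → LowLevel r → LowLevel (⟪ r ⟫ S)
  plug-lowLevel hole       r = r
  plug-lowLevel (let′ u S) r = let′ (stuck⇒lowLevel u) (plug-lowLevel S r)
  plug-lowLevel (letp v S) r = letp (neutral⇒lowLevel v) (plug-lowLevel S r)

  plug-normal : {S : SubstList n m} {r : Tm m} →
                Frozen S → Normal r → Normal (⟪ r ⟫ S)
  plug-normal hole       r = r
  plug-normal (let′ u S) r = let-normal u (stuck⇒normal u) (plug-normal S r)
  plug-normal (letp v S) r = letp-normal v (plug-normal S r)

  -- An answer with a stuck result is stuck as a whole, hence may itself be bound in a frozen list.
  plug-stuck : {S : SubstList n m} {r : Tm m} → Frozen S → Stuck r → Stuck (⟪ r ⟫ S)
  plug-stuck hole       r = r
  plug-stuck (let′ u S) r = let′ u (plug-stuck S r)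
  plug-stuck (letp v S) r = letp v (plug-stuck S r)

  plug-⟶* : (S : SubstList n m) {t u : Tm m} → t ⟶* u → ⟪ t ⟫ S ⟶* ⟪ u ⟫ S
  plug-⟶* hole       r = r
  plug-⟶* (let′ u S) r = gmap (let′ u) E-let₂ (plug-⟶* S r)
  plug-⟶* (letp v S) r = gmap (letp v) E-letp (plug-⟶* S r)

  -- `V` is a family over all scopes because the result lives under the binders of `S`.
  record Answer (V : ∀ {m} → Tm m → Set ℓ) {n} (t : Tm n) : Set ℓ where
    constructor answer
    field
      {scope} : ℕ
      {S}     : SubstList n scope
      {r}     : Tm scope
      steps   : t ⟶* ⟪ r ⟫ S
      frozen  : Frozen S
      result  : V r

  module _ {V : ∀ {m} → Tm m → Set ℓ} where

    answer-map : {W : ∀ {m} → Tm m → Set ℓ} →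
                 (∀ {m} {r : Tm m} → V r → W r) → {t : Tm n} → Answer V t → Answer W t
    answer-map f (answer steps S r) = answer steps S (f r)

    answer-⟶* : {t u : Tm n} → t ⟶* u → Answer V u → Answer V t
    answer-⟶* r (answer steps S v) = answer (r ◅◅ steps) S v

    answer-let : {u : Tm n} {t : Tm (suc n)} →
                 Stuck u → Answer V t → Answer V (let′ u t)
    answer-let u (answer steps S v) = answer (gmap (let′ _) E-let₂ steps) (let′ u S) v

    answer-letp : {v : Val n} {t : Tm (suc (suc n))} →
                  Neutral v → Answer V t → Answer V (letp v t)
    answer-letp v (answer steps S w) = answer (gmap (letp _) E-letp steps) (letp v S) w

    -- Reduction is allowed in the bodies of `let′` and `letp`, so the hole can be evaluated in
    -- place and its own frozen list ends up nested inside `S`.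
    answer-plug : {S : SubstList n m} {t : Tm m} →
                  Frozen S → Answer V t → Answer V (⟪ t ⟫ S)
    answer-plug hole       a = a
    answer-plug (let′ u S) a = answer-let u (answer-plug S a)
    answer-plug (letp v S) a = answer-letp v (answer-plug S a)

    -- Values do not reduce, so the reduction is empty; a plugged list equal to a value must be the
    -- bare hole.
    answer-val : {v : Val n} → Answer V (val v) → V (val v)
    answer-val (answer {S = hole} ε _ v)    = v
    answer-val (answer (root () ◅ _) _ _)

  -- The interpretation of types

  -- Guards the stuck results in `⟦_⟧ʳ`. A `let′` whose bound term gets stuck keeps its variable,
  -- and a variable inhabits every ground type but no nonempty multiset type.
  data Ground : PosTy → Set where
    ground : ∀ {L} → Ground (ground L)

  mutual
    ⟦_⟧ : Ty → ∀ {n} → Tm n → Set ℓ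
    ⟦ A ⟧ t = Answer ⟦ A ⟧ʳ t

    -- Arguments of a function range over the scope of the lambda itself. Contexts contain only
    -- positive types, so a function reaches an environment only inside a bang, where `⟦_⟧*`
    -- supplies the renamings.
    ⟦_⟧ʳ : Ty → ∀ {n} → Tm n → Set ℓ
    ⟦ pos P ⟧ʳ r = (∃[ v ] (r ≡ val v × ⟦ P ⟧ᵛ v)) ⊎ (Ground P × Stuck r)
    ⟦ P ⊸ A ⟧ʳ r = ∃[ t ] (r ≡ lam t × (∀ v → ⟦ P ⟧ᵛ v → ⟦ A ⟧ (t [ v ])))

    ⟦_⟧ᵛ : PosTy → ∀ {n} → Val n → Set ℓ
    ⟦ ground L ⟧ᵛ v = LowLevelVal v
    ⟦ mset As ⟧ᵛ  v = ⟦ As ⟧* v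

    -- The quantification over renamings makes values stable under weakening
    -- without a renaming lemma for reduction.
    ⟦_⟧* : List Ty → ∀ {n} → Val n → Set ℓ
    ⟦ [] ⟧*     v = ⊤
    ⟦ A ∷ As ⟧* {n} v =
      (∃[ t ] (v ≡ bang t × (∀ {m} (ρ : Ren n m) → ⟦ A ⟧ (ren ρ t)))) × ⟦ As ⟧* v

  value : ∀ P {v : Val n} → ⟦ P ⟧ᵛ v → ⟦ pos P ⟧ (val v)
  value P v = answer ε hole (inj₁ (_ , refl , v))

  value⁻¹ : ∀ P {v : Val n} → ⟦ pos P ⟧ (val v) → ⟦ P ⟧ᵛ v
  value⁻¹ P a with answer-val a
  -- The stuck alternative is empty, since no value is `Stuck`.
  ... | inj₁ (_ , refl , v) = v

  stuck : ∀ {L} {t : Tm n} → Stuck t → ⟦ pos (ground L) ⟧ t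
  stuck s = answer ε hole (inj₂ (ground , s))

  mutual
    renᵛ-⟦⟧ᵛ : ∀ P (ρ : Ren m n) {v} → ⟦ P ⟧ᵛ v → ⟦ P ⟧ᵛ (renᵛ ρ v)
    renᵛ-⟦⟧ᵛ (ground L) ρ v = renᵛ-lowLevel v
    renᵛ-⟦⟧ᵛ (mset As)  ρ v = renᵛ-⟦⟧* As ρ v

    renᵛ-⟦⟧* : ∀ As (ρ : Ren m n) {v} → ⟦ As ⟧* v → ⟦ As ⟧* (renᵛ ρ v)
    renᵛ-⟦⟧* []       ρ _ = tt
    renᵛ-⟦⟧* (A ∷ As) ρ ((t , refl , a) , as) =
      (ren ρ t , refl , λ ρ′ → subst ⟦ A ⟧ (sym (ren-ren (λ _ → refl) t)) (a (ρ′ ∘ ρ))) ,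
      renᵛ-⟦⟧* As ρ as

  ground-resp : ∀ {P Q} → P ≈ᴾ Q → Ground P ⇔ Ground Q
  ground-resp ground   = mk⇔ id id
  ground-resp (mset _) = mk⇔ (λ ()) (λ ())

  mutual
    -- Both directions are proved together because the domain of an arrow is contravariant: each
    -- direction at `P ⊸ A` uses the opposite one at `P`.
    ⟦⟧-resp : ∀ {A B} → A ≈ B → {t : Tm n} → ⟦ A ⟧ t ⇔ ⟦ B ⟧ t
    ⟦⟧-resp A≈B = mk⇔ (answer-map (to (⟦⟧ʳ-resp A≈B))) (answer-map (from (⟦⟧ʳ-resp A≈B)))

    ⟦⟧ʳ-resp : ∀ {A B} → A ≈ B → {r : Tm n} → ⟦ A ⟧ʳ r ⇔ ⟦ B ⟧ʳ r
    ⟦⟧ʳ-resp (pos P≈Q) = mk⇔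
      (Sum.map (map₂ (map₂ (to (⟦⟧ᵛ-resp P≈Q)))) (map₁ (to (ground-resp P≈Q))))
      (Sum.map (map₂ (map₂ (from (⟦⟧ᵛ-resp P≈Q)))) (map₁ (from (ground-resp P≈Q))))
    ⟦⟧ʳ-resp (P≈Q ⊸ A≈B) = mk⇔
      (map₂ (map₂ λ f v b → to (⟦⟧-resp A≈B) (f v (from (⟦⟧ᵛ-resp P≈Q) b))))
      (map₂ (map₂ λ f v a → from (⟦⟧-resp A≈B) (f v (to (⟦⟧ᵛ-resp P≈Q) a))))

    ⟦⟧ᵛ-resp : ∀ {P Q} → P ≈ᴾ Q → {v : Val n} → ⟦ P ⟧ᵛ v ⇔ ⟦ Q ⟧ᵛ v
    ⟦⟧ᵛ-resp ground   = mk⇔ id id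
    ⟦⟧ᵛ-resp (mset p) = ⟦⟧*-resp p

    ⟦⟧*-resp : ∀ {As Bs} → Homogeneous.Permutation _≈_ As Bs →
               {v : Val n} → ⟦ As ⟧* v ⇔ ⟦ Bs ⟧* v
    ⟦⟧*-resp (Homogeneous.refl eqs) = ⟦⟧*-resp-pointwise eqs
    ⟦⟧*-resp (Homogeneous.prep A≈B p) = mk⇔
      (λ { ((t , eq , a) , as) →
           (t , eq , λ ρ → to (⟦⟧-resp A≈B) (a ρ)) , to (⟦⟧*-resp p) as })
      (λ { ((t , eq , b) , bs) →
           (t , eq , λ ρ → from (⟦⟧-resp A≈B) (b ρ)) , from (⟦⟧*-resp p) bs })
    ⟦⟧*-resp (Homogeneous.swap A≈A′ B≈B′ p) = mk⇔
      (λ { ((t , eq , a) , (u , eq′ , b) , as) →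
           (u , eq′ , λ ρ → to (⟦⟧-resp B≈B′) (b ρ)) ,
           (t , eq , λ ρ → to (⟦⟧-resp A≈A′) (a ρ)) , to (⟦⟧*-resp p) as })
      (λ { ((u , eq′ , b) , (t , eq , a) , as) →
           (t , eq , λ ρ → from (⟦⟧-resp A≈A′) (a ρ)) ,
           (u , eq′ , λ ρ → from (⟦⟧-resp B≈B′) (b ρ)) , from (⟦⟧*-resp p) as })
    ⟦⟧*-resp (Homogeneous.trans p q) = mk⇔
      (λ as → to (⟦⟧*-resp q) (to (⟦⟧*-resp p) as))
      (λ as → from (⟦⟧*-resp p) (from (⟦⟧*-resp q) as))

    ⟦⟧*-resp-pointwise : ∀ {As Bs} → Pointwise _≈_ As Bs →
                         {v : Val n} → ⟦ As ⟧* v ⇔ ⟦ Bs ⟧* v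
    ⟦⟧*-resp-pointwise []          = mk⇔ id id
    ⟦⟧*-resp-pointwise (A≈B ∷ eqs) = mk⇔
      (λ { ((t , eq , a) , as) →
           (t , eq , λ ρ → to (⟦⟧-resp A≈B) (a ρ)) , to (⟦⟧*-resp-pointwise eqs) as })
      (λ { ((t , eq , b) , bs) →
           (t , eq , λ ρ → from (⟦⟧-resp A≈B) (b ρ)) , from (⟦⟧*-resp-pointwise eqs) bs })

  ⟦++⟧*⁻ : ∀ As {Bs} {v : Val n} → ⟦ As ++ Bs ⟧* v → ⟦ As ⟧* v × ⟦ Bs ⟧* v
  ⟦++⟧*⁻ []       bs       = tt , bs
  ⟦++⟧*⁻ (A ∷ As) (a , as) = map₁ (a ,_) (⟦++⟧*⁻ As as)

  -- Environments

  infix 3 _⊨_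
  _⊨_ : Sub m n → Ctx m → Set ℓ
  σ ⊨ Γ = ∀ x → ⟦ lookup Γ x ⟧ᵛ (σ x)

  ⊨-• : ∀ {σ : Sub m n} {Γ P v} → ⟦ P ⟧ᵛ v → σ ⊨ Γ → v • σ ⊨ P ∷ Γ
  ⊨-• v s zero    = v
  ⊨-• v s (suc x) = s x

  ⊨-ren : ∀ {σ : Sub l m} Γ (ρ : Ren m n) → σ ⊨ Γ → renᵛ ρ ∘ σ ⊨ Γ
  ⊨-ren Γ ρ s x = renᵛ-⟦⟧ᵛ (lookup Γ x) ρ (s x)

  -- For binders that survive reduction: the new variable stands for itself, a low-level value and
  -- so an inhabitant of any ground type.
  ⊨-ext : ∀ {σ : Sub m n} {Γ L} → σ ⊨ Γ → ext σ ⊨ ground L ∷ Γ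
  ⊨-ext s zero            = var zero
  ⊨-ext {Γ = Γ} s (suc x) = ⊨-ren Γ suc s x

  -- One environment serves both premises: ground entries are shared, and inhabiting a concatenated
  -- multiset means inhabiting both parts.
  ⊨-⊎ : ∀ {σ : Sub m n} {Γ₁ Γ₂ Γ} → Γ₁ ⊎ Γ₂ ≔ Γ → σ ⊨ Γ → (σ ⊨ Γ₁) × (σ ⊨ Γ₂)
  ⊨-⊎ split s = (λ x → proj₁ (at split s x)) , (λ x → proj₂ (at split s x))
    where
    at : ∀ {σ : Sub m n} {Γ₁ Γ₂ Γ} → Γ₁ ⊎ Γ₂ ≔ Γ → σ ⊨ Γ →
         ∀ x → ⟦ lookup Γ₁ x ⟧ᵛ (σ x) × ⟦ lookup Γ₂ x ⟧ᵛ (σ x)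
    at (ground ∷ _)            s zero    = s zero , s zero
    at (mset {As = As} ∷ _)    s zero    = ⟦++⟧*⁻ As (s zero)
    at {σ = σ} (_ ∷ split)     s (suc x) = at {σ = σ ∘ suc} split (s ∘ suc) x

  ⊨-groundPart : ∀ {σ : Sub m n} Γ → σ ⊨ Γ → σ ⊨ groundPart Γ
  ⊨-groundPart (ground L ∷ Γ) s zero    = s zero
  ⊨-groundPart (mset As ∷ Γ)  s zero    = tt
  ⊨-groundPart (_ ∷ Γ)        s (suc x) = ⊨-groundPart Γ (s ∘ suc) x

  ⊨-resp : ∀ {σ : Sub m n} {Γ Γ′} → Γ ≈ᶜ Γ′ → σ ⊨ Γ′ → σ ⊨ Γ
  ⊨-resp (P≈Q ∷ _) s zero    = from (⟦⟧ᵛ-resp P≈Q) (s zero)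
  ⊨-resp (_ ∷ eqs) s (suc x) = ⊨-resp eqs (s ∘ suc) x

  noMultiset-var : ∀ {P} → NoMultiset P → (x : Fin n) → ⟦ P ⟧ᵛ (var x)
  noMultiset-var ground x = var x
  noMultiset-var empty  x = tt

  ⊨-var : {Γ : Ctx n} → GroundCtx Γ → var ⊨ Γ
  ⊨-var g x = noMultiset-var (lookup⁺ g x) x

  -- An environment may replace the scrutinised variables by pairs or booleans; their ground types
  -- still force low-level values, so the tuple remains admissible in a stuck `case`.
  sub-vars-lowLevel : {σ : Sub m n} (Γ : Ctx m) → σ ⊨ Γ →
                      (ys : Vec (Fin m) (suc k)) (Ys : Vec Name (suc k)) →
                      (∀ i → lookup Γ (lookup ys i) ≡ ground (name (lookup Ys i))) →
                      LowLevelVal (subᵛ σ (tuple (Vec.map var ys)))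
  sub-vars-lowLevel {σ = σ} Γ s (y ∷ [])      (Y ∷ [])      eqs =
    subst (λ P → ⟦ P ⟧ᵛ (σ y)) (eqs zero) (s y)
  sub-vars-lowLevel {σ = σ} Γ s (y ∷ y′ ∷ ys) (Y ∷ Y′ ∷ Ys) eqs =
    pair (subst (λ P → ⟦ P ⟧ᵛ (σ y)) (eqs zero) (s y))
         (sub-vars-lowLevel Γ s (y′ ∷ ys) (Y′ ∷ Ys) (eqs ∘ suc))

  -- The fundamental lemma

  mutual
    -- Induction on the derivation. Generality over `σ` and its target scope lets binders be crossed
    -- either by a value or by the variable itself.
    fundamental : ∀ {Γ : Ctx m} {t A} → Γ ⊢ t ∶ A →
                  {σ : Sub m n} → σ ⊨ Γ → ⟦ A ⟧ (sub σ t)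
    fundamental (i-sample _ _) s = stuck (sample _)
    fundamental (i-cond {Λ = Λ} ys Ys d _ eqs p _) {σ} s =
      stuck (case d (sub-vars-lowLevel Λ s ys Ys eqs) (subᵇ-table σ d p))
    fundamental (i-var {x = x} refl _) s = value _ (s x)
    fundamental (i-let {Γ₂ = Γ₂} {t = t} {P = P} split D₁ D₂) {σ} s
      with s₁ , s₂ ← ⊨-⊎ split s
      with fundamental D₁ s₁
    -- The bound term yields a value under `S`: `β-let` moves `S` outwards, and the body continues
    -- inside it with the environment weakened.
    ... | answer {S = S} steps S-frozen (inj₁ (v , refl , Pv)) =
      answer-⟶* (gmap (λ u → let′ u _) E-let₁ steps ◅◅ root (β-let S v _) ◅ ε)
        (answer-plug S-frozen
          (subst ⟦ _ ⟧ (sym (ren-sub-ext-[] (weaken S) σ t v))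
            (fundamental D₂ (⊨-• {P = P} Pv (⊨-ren Γ₂ (weaken S) s₂)))))
    ... | answer steps S-frozen (inj₂ (ground , r)) =
      answer-⟶* (gmap (λ u → let′ u _) E-let₁ steps)
        (answer-let (plug-stuck S-frozen r) (fundamental D₂ (⊨-ext s₂)))
    fundamental (i-pair {L₁ = L₁} {L₂ = L₂} _ D₁ D₂) s =
      value (ground (L₁ ⊗ L₂))
        (pair (value⁻¹ (ground L₁) (fundamental D₁ s))
              (value⁻¹ (ground L₂) (fundamental D₂ s)))
    fundamental (i-letp {Γ = Γ} {v = v} {t} {L₁} {L₂} D₁ D₂) {σ} s
      -- A value of type `L₁ ⊗ L₂` is only known to be low-level: a variable or boolean freezes the
      -- `letp`, a pair fires it.
      with subᵛ σ v | value⁻¹ (ground (L₁ ⊗ L₂)) (fundamental D₁ (⊨-groundPart Γ s))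
    ... | _ | var x   = answer-letp (var x) (fundamental D₂ (⊨-ext (⊨-ext s)))
    ... | _ | bool b  = answer-letp (bool b) (fundamental D₂ (⊨-ext (⊨-ext s)))
    ... | _ | pair {v₁} {v₂} l₁ l₂ =
      answer-⟶* (root (β-letp v₁ v₂ _) ◅ ε)
        (subst ⟦ _ ⟧ (sym (sub-ext-ext-[] σ t v₁ v₂))
          (fundamental D₂
            (⊨-• {P = ground L₂} l₂ (⊨-• {P = ground L₁} l₁ s))))
    fundamental (i-abs {t = t} {P = P} D) {σ} s =
      answer ε hole (_ , refl , λ v Pv →
        subst ⟦ _ ⟧ (sym (sub-ext-[] σ t v)) (fundamental D (⊨-• {P = P} Pv s)))
    fundamental (i-app {P = P} split D₁ D₂) s
      with s₁ , s₂ ← ⊨-⊎ split s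
      with fundamental D₁ s₁
    -- `β-lam` brings the argument under `S`, hence its renaming along `weaken S`.
    ... | answer {S = S} steps S-frozen (t , refl , f) =
      answer-⟶* (gmap (λ t → app t _) E-app steps ◅◅ root (β-lam S t _) ◅ ε)
        (answer-plug S-frozen
          (f _ (renᵛ-⟦⟧ᵛ P (weaken S) (value⁻¹ P (fundamental D₂ s₂)))))
    fundamental (i-bang {As = As} Ds) s = value (mset As) (fundamental! Ds s)
    fundamental (i-der {v = v} {A} D) {σ} s
      with subᵛ σ v | value⁻¹ (mset (A ∷ [])) (fundamental D s)
    ... | _ | (t , refl , a) , _ =
      -- The body of the bang is used in its own scope, so its reducibility is instantiated at the
      -- identity renaming.
      answer-⟶* (root (β-der t) ◅ ε) (subst ⟦ A ⟧ (ren-id t) (a id))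
    fundamental (i-conv Γ≈Γ′ A≈A′ D) s =
      to (⟦⟧-resp A≈A′) (fundamental D (⊨-resp Γ≈Γ′ s))

    fundamental! : ∀ {Γ : Ctx m} {t As} → Γ ⊢! t ∶ As →
                   {σ : Sub m n} → σ ⊨ Γ → ⟦ As ⟧* (bang (sub σ t))
    fundamental! ([] _) s = tt
    fundamental! (add {Γ₁} {t = t} split D Ds) {σ} s with s₁ , s₂ ← ⊨-⊎ split s =
      -- A renaming of the bang's body is absorbed into the environment, where the induction
      -- hypothesis applies again.
      (sub σ t , refl , λ ρ →
        subst ⟦ _ ⟧ (sym (ren-sub (λ _ → refl) t)) (fundamental D (⊨-ren Γ₁ ρ s₁))) ,
      fundamental! Ds s₂

  -- Extraction of the low-level normal form

  -- At a ground type the result of an answer is a low-level value or a stuck term. Either is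
  -- low-level and normal, and a frozen list around it preserves both properties.
  normalise : ∀ {L} {t : Tm n} → ⟦ pos (ground L) ⟧ t →
              ∃[ u ] (t ⟶* u × LowLevel u × Normal u)
  normalise (answer steps S (inj₁ (v , refl , l))) =
    _ , steps , plug-lowLevel S (val l) , plug-normal S (val-normal v)
  normalise (answer steps S (inj₂ (_ , r))) =
    _ , steps , plug-lowLevel S (stuck⇒lowLevel r) , plug-normal S (stuck⇒normal r)

theorem4p6 : ∀ {c ℓ₁ ℓ₂} (R : OrderedRing c ℓ₁ ℓ₂) → let open Calculus R in
    ∀ {n} (Λ : Ctx n) (t : Tm n) (L : GroundTy) →
    GroundCtx Λ → Derivable Λ t (pos (ground L)) →
    ∃[ u ] (t ⟶* u × LowLevel u × Normal u)
theorem4p6 R Λ t L g (D , _) =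
  -- The identity substitution is a valid environment for a ground context: variables inhabit ground
  -- types, and everything inhabits the empty multiset.
  normalise (subst ⟦ pos (ground L) ⟧ (sub-id (λ _ → refl) t) (fundamental D (⊨-var g)))
  where open Normalisation R
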